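{- Let $G$ be a finite abelian group, let $t\ge2$, and let $H_1,\dots,H_t$ be distinct subgroups of $G$ and $D$ a subgroup with $H_i\cap H_j=D$ for all $i\neq j$ and $|H_i:D|>2$ for all $1\le i\le t$. Let $H=H_1+\dots+H_t$. Let $\mathcal{A}$ consist of the following subsets of $G$: (1) $A_i=H_i\setminus D$ for $1\le i\le t$; (2) all cosets of $D$ that are contained in $H$ but not contained in $H_1\cup\dots\cup H_t$; (3) for some chosen set (possibly empty) of cosets of $H$ different from $H$ itself, all the cosets of $D$ lying within those cosets of $H$. Then $\mathcal{A}$ is a bimodal collection of pairwise disjoint subsets of $G$; moreover, the members $S$ of $\mathcal{A}$ with $|S|$ smaller than the order of the internal difference group of $S$ are exactly $A_1,\dots,A_t$, the internal difference group of $A_i$ is $H_i$, and $(H_i)\setminus A_i=D$ is a subgroup (so $\mathcal{A}$ is in canonical position).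
   Context: $G$ is written additively. The internal difference group of a subset $S\subseteq G$ is the subgroup generated by all $x-y$ with $x,y\in S$. A collection $\{A_1,\dots,A_m\}$ of pairwise disjoint subsets of $G$ is bimodal if for every $i$ and every $\delta\in G\setminus\{0\}$, the number $N_i(\delta)$ of pairs $(a,b)$ with $a\in A_i$, $b\in A_j$ for some $j\neq i$, and $a-b=\delta$, satisfies $N_i(\delta)\in\{0,|A_i|\}$. -}

module Defs where

open import Algebra.Bundles using (AbelianGroup)
import Data.Bool.Properties as Bool
open import Data.Fin using (Fin; _≟_)
open import Data.Fin.Properties using (any?; all?)
open import Data.Fin.Subset using (Subset; _∈_; _⊆_; _⊈_; _∩_; _─_; ⋃; Empty; ∣_∣)
open import Data.Fin.Subset.Properties using (_∈?_; _⊆?_; anySubset?)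
open import Data.List using (List; length; map; filter; deduplicate; foldr; tabulate; allFin; cartesianProduct)
open import Data.Nat using (ℕ)
open import Data.Product using (∃; _×_; _,_)
open import Data.Sum using (_⊎_)
import Data.Vec as Vec
import Data.Vec.Properties as Vec
open import Function using (_∘_; _⇔_; mk⇔; Inverse)
open import Level using (Level; 0ℓ; _⊔_) renaming (suc to lsuc)
open import Relation.Binary using (DecidableEquality)
open import Relation.Binary.PropositionalEquality using (_≡_; _≢_; subst; setoid) renaming (trans to ≡-trans)
open import Relation.Nullary using (Dec; ¬_; does; ¬?)
open import Relation.Nullary.Decidable using (map′; decidable-stable; does-⇔; _×-dec_; _⊎-dec_; _→-dec_)
open import Relation.Unary using (Pred; Decidable)
open import Relation.Binary.Definitions using (_Respects_)

record FiniteAbelianGroup (c ℓ : Level) : Set (lsuc (c ⊔ ℓ)) where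
  field
    abelianGroup : AbelianGroup c ℓ
    order        : ℕ
    enumeration  : Inverse (AbelianGroup.setoid abelianGroup) (setoid (Fin order))

module Subsets {c ℓ : Level} (G : FiniteAbelianGroup c ℓ) where

  open FiniteAbelianGroup G public
  open AbelianGroup abelianGroup public
    using (Carrier; _≈_; refl; trans; ∙-congʳ; ∙-congˡ; ⁻¹-cong)
    renaming (_∙_ to infixl 6 _+_; ε to 0#; _⁻¹ to infix 8 -_; sym to ≈-sym)
  open Inverse enumeration public
    using (to; from; to-cong; strictlyInverseˡ; strictlyInverseʳ)

  infixl 6 _-_
  _-_ : Carrier → Carrier → Carrier
  x - y = x + (- y)

  -- Subsets of G are subsets of the index set Fin order, so that equality of
  -- sets is _≡_ and cardinality is ∣_∣ from Data.Fin.Subset.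
  𝒫G : Set
  𝒫G = Subset order

  infix 4 _∈ᴳ_ _∈ᴳ?_ _≈?_ _≟ˢ_

  _∈ᴳ_ : Carrier → 𝒫G → Set
  x ∈ᴳ S = to x ∈ S

  _∈ᴳ?_ : ∀ x S → Dec (x ∈ᴳ S)
  x ∈ᴳ? S = to x ∈? S

  ∈ᴳ-resp : ∀ S → (_∈ᴳ S) Respects _≈_
  ∈ᴳ-resp S x≈y = subst (_∈ S) (to-cong x≈y)

  to-injective : ∀ {x y} → to x ≡ to y → x ≈ y
  to-injective {x} {y} p = trans (≈-sym (strictlyInverseʳ x))
    (trans (Inverse.from-cong enumeration p) (strictlyInverseʳ y))

  _≈?_ : ∀ x y → Dec (x ≈ y)
  x ≈? y = map′ to-injective to-cong (to x ≟ to y)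

  _≟ˢ_ : DecidableEquality 𝒫G
  _≟ˢ_ = Vec.≡-dec Bool._≟_

  anyᴳ? : ∀ {p} {P : Pred Carrier p} → P Respects _≈_ → Decidable P → Dec (∃ P)
  anyᴳ? resp P? = map′ (λ (i , p) → from i , p)
                       (λ (x , p) → to x , resp (≈-sym (strictlyInverseʳ x)) p)
                       (any? (P? ∘ from))

  allᴳ? : ∀ {p} {P : Pred Carrier p} → P Respects _≈_ → Decidable P → Dec (∀ x → P x)
  allᴳ? resp P? = map′ (λ h x → resp (strictlyInverseʳ x) (h (to x)))
                       (λ h i → h (from i))
                       (all? (P? ∘ from))

  allSubset? : ∀ {p} {P : Pred 𝒫G p} → Decidable P → Dec (∀ S → P S)
  allSubset? P? = map′ (λ ¬∃ S → decidable-stable (P? S) (λ ¬p → ¬∃ (S , ¬p)))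
                       (λ h (S , ¬p) → ¬p (h S))
                       (¬? (anySubset? (¬? ∘ P?)))

  elements : List Carrier
  elements = map from (allFin order)

  -- The set { x ∈ G | P x }, for P respecting _≈_.
  ⟦_⟧ : ∀ {p} {P : Pred Carrier p} → Decidable P → 𝒫G
  ⟦ P? ⟧ = Vec.tabulate (λ i → does (P? (from i)))

  ⟦⟧-cong : ∀ {p q} {P : Pred Carrier p} {Q : Pred Carrier q}
            (P? : Decidable P) (Q? : Decidable Q) →
            (∀ x → P x ⇔ Q x) → ⟦ P? ⟧ ≡ ⟦ Q? ⟧
  ⟦⟧-cong P? Q? P⇔Q =
    Vec.tabulate-cong (λ i → does-⇔ (P⇔Q (from i)) (P? (from i)) (Q? (from i)))

  infixr 6 _⊕_
  _⊕_ : 𝒫G → 𝒫G → 𝒫G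
  S ⊕ T = ⟦ sum? ⟧
    where
    sum? : Decidable (λ x → ∃ λ s → s ∈ᴳ S × ∃ λ t → t ∈ᴳ T × x ≈ s + t)
    sum? x =
      anyᴳ? (λ s≈s′ (s∈ , t , t∈ , e) →
               ∈ᴳ-resp S s≈s′ s∈ , t , t∈ , trans e (∙-congʳ s≈s′))
            (λ s → (s ∈ᴳ? S) ×-dec
              anyᴳ? (λ t≈t′ (t∈ , e) → ∈ᴳ-resp T t≈t′ t∈ , trans e (∙-congˡ t≈t′))
                    (λ t → (t ∈ᴳ? T) ×-dec (x ≈? s + t)))

  sumOf : ∀ {t} → (Fin t → 𝒫G) → 𝒫G
  sumOf H = foldr _⊕_ ⟦ _≈? 0# ⟧ (tabulate H)

  unionOf : ∀ {t} → (Fin t → 𝒫G) → 𝒫G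
  unionOf H = ⋃ (tabulate H)

  InCoset : Carrier → 𝒫G → Pred Carrier (c ⊔ ℓ)
  InCoset g K x = ∃ λ k → k ∈ᴳ K × x ≈ g + k

  inCoset? : ∀ g K → Decidable (InCoset g K)
  inCoset? g K x =
    anyᴳ? (λ k≈k′ (k∈ , e) → ∈ᴳ-resp K k≈k′ k∈ , trans e (∙-congˡ k≈k′))
          (λ k → (k ∈ᴳ? K) ×-dec (x ≈? g + k))

  infixr 6 _+ˢ_
  _+ˢ_ : Carrier → 𝒫G → 𝒫G
  g +ˢ K = ⟦ inCoset? g K ⟧

  IsCoset : 𝒫G → 𝒫G → Set c
  IsCoset K C = ∃ λ g → C ≡ g +ˢ K

  isCoset? : ∀ K → Decidable (IsCoset K)
  isCoset? K C = anyᴳ? (λ g≈h e → ≡-trans e (+ˢ-cong g≈h)) (λ g → C ≟ˢ g +ˢ K)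
    where
    +ˢ-cong : ∀ {g h} → g ≈ h → g +ˢ K ≡ h +ˢ K
    +ˢ-cong {g} {h} g≈h = ⟦⟧-cong (inCoset? g K) (inCoset? h K) λ _ → mk⇔
      (λ (k , k∈ , e) → k , k∈ , trans e (∙-congʳ g≈h))
      (λ (k , k∈ , e) → k , k∈ , trans e (∙-congʳ (≈-sym g≈h)))

  -- The index: the number of distinct sets h + D with h ∈ H.
  ∣_∶_∣ : 𝒫G → 𝒫G → ℕ
  ∣ H ∶ D ∣ = length (deduplicate _≟ˢ_ (map (_+ˢ D) (filter (_∈ᴳ? H) elements)))

  IsSubgroup : 𝒫G → Set c
  IsSubgroup K = 0# ∈ᴳ K
               × (∀ x → x ∈ᴳ K → ∀ y → y ∈ᴳ K → x + y ∈ᴳ K)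
               × (∀ x → x ∈ᴳ K → - x ∈ᴳ K)

  isSubgroup? : Decidable IsSubgroup
  isSubgroup? K =
    (0# ∈ᴳ? K)
    ×-dec allᴳ? (λ x≈x′ h x′∈ y y∈ →
                   ∈ᴳ-resp K (∙-congʳ x≈x′) (h (∈ᴳ-resp K (≈-sym x≈x′) x′∈) y y∈))
                (λ x → (x ∈ᴳ? K) →-dec
                  allᴳ? (λ y≈y′ h y′∈ →
                           ∈ᴳ-resp K (∙-congˡ y≈y′) (h (∈ᴳ-resp K (≈-sym y≈y′) y′∈)))
                        (λ y → (y ∈ᴳ? K) →-dec (x + y ∈ᴳ? K)))
    ×-dec allᴳ? (λ x≈x′ h x′∈ →
                   ∈ᴳ-resp K (⁻¹-cong x≈x′) (h (∈ᴳ-resp K (≈-sym x≈x′) x′∈)))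
                (λ x → (x ∈ᴳ? K) →-dec (- x ∈ᴳ? K))

  -- The subgroup generated by X: the intersection of all subgroups containing X.
  ⟨_⟩ : 𝒫G → 𝒫G
  ⟨ X ⟩ = ⟦ generated? ⟧
    where
    generated? : Decidable (λ x → ∀ K → IsSubgroup K × X ⊆ K → x ∈ᴳ K)
    generated? x =
      allSubset? (λ K → (isSubgroup? K ×-dec (X ⊆? K)) →-dec (x ∈ᴳ? K))

  differences : 𝒫G → 𝒫G
  differences S = ⟦ difference? ⟧
    where
    difference? : Decidable (λ z → ∃ λ x → x ∈ᴳ S × ∃ λ y → y ∈ᴳ S × z ≈ x - y)
    difference? z =
      anyᴳ? (λ x≈x′ (x∈ , y , y∈ , e) →
               ∈ᴳ-resp S x≈x′ x∈ , y , y∈ , trans e (∙-congʳ x≈x′))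
            (λ x → (x ∈ᴳ? S) ×-dec
              anyᴳ? (λ y≈y′ (y∈ , e) →
                       ∈ᴳ-resp S y≈y′ y∈ , trans e (∙-congˡ (⁻¹-cong y≈y′)))
                    (λ y → (y ∈ᴳ? S) ×-dec (z ≈? x - y)))

  internalDifferenceGroup : 𝒫G → 𝒫G
  internalDifferenceGroup S = ⟨ differences S ⟩

  -- A collection of subsets is a decidable predicate on 𝒫G. Being a set of
  -- sets, it is indexed by its own members: "j ≠ i" becomes "T ≢ S".

  PairwiseDisjoint : ∀ {a} → Pred 𝒫G a → Set a
  PairwiseDisjoint 𝒜 = ∀ S T → 𝒜 S → 𝒜 T → S ≢ T → Empty (S ∩ T)

  -- The number of pairs (a , b) with a ∈ S, b in a member of 𝒜 other than S,
  -- and a - b = δ.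
  N : ∀ {a} {𝒜 : Pred 𝒫G a} → Decidable 𝒜 → 𝒫G → Carrier → ℕ
  N {𝒜 = 𝒜} 𝒜? S δ = length (filter pair? (cartesianProduct elements elements))
    where
    pair? : Decidable (λ ((a , b) : Carrier × Carrier) →
              a ∈ᴳ S × (∃ λ T → 𝒜 T × T ≢ S × b ∈ᴳ T) × a - b ≈ δ)
    pair? (a , b) =
      (a ∈ᴳ? S)
      ×-dec anySubset? (λ T → 𝒜? T ×-dec ¬? (T ≟ˢ S) ×-dec (b ∈ᴳ? T))
      ×-dec (a - b ≈? δ)

  Bimodal : ∀ {a} {𝒜 : Pred 𝒫G a} → Decidable 𝒜 → Set (a ⊔ c ⊔ ℓ)
  Bimodal {𝒜 = 𝒜} 𝒜? =
    ∀ S → 𝒜 S → ∀ δ → ¬ (δ ≈ 0#) → N 𝒜? S δ ≡ 0 ⊎ N 𝒜? S δ ≡ ∣ S ∣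

  -- H₁ , … , H_t with the subgroup D, and 𝒞 the chosen set of cosets of
  -- H₁ + … + H_t.
  module Construction {t : ℕ} (H : Fin t → 𝒫G) (D : 𝒫G)
                      {𝒞 : Pred 𝒫G 0ℓ} (𝒞? : Decidable 𝒞) where

    A : Fin t → 𝒫G
    A i = H i ─ D

    𝒜 : Pred 𝒫G c
    𝒜 S = (∃ λ i → S ≡ A i)
        ⊎ (IsCoset D S × S ⊆ sumOf H × S ⊈ unionOf H)
        ⊎ (IsCoset D S × ∃ λ C → 𝒞 C × S ⊆ C)

    𝒜? : Decidable 𝒜
    𝒜? S = any? (λ i → S ≟ˢ A i)
      ⊎-dec (isCoset? D S ×-dec (S ⊆? sumOf H) ×-dec ¬? (S ⊆? unionOf H))
      ⊎-dec (isCoset? D S ×-dec anySubset? (λ C → 𝒞? C ×-dec (S ⊆? C)))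

{-# OPTIONS --safe #-}

-- For S ∈ 𝒜, N S δ counts the a ∈ S for which a - δ lies in another member of
-- 𝒜, i.e. in the union E of 𝒜 but outside S; so bimodality means that this
-- condition does not depend on a ∈ S. The set E is ΣH \ D, where ΣH = sumOf H,
-- together with the chosen cosets of ΣH. As a union of cosets of D it settles the
-- members that are cosets of D. For S = A i, the translate by - δ lies in one coset
-- of H i: either H i itself, which meets E only in A i, or a coset that avoids D
-- and is therefore contained in E or disjoint from it.

module Submission where

open import Defs
open import Algebra.Bundles using (AbelianGroup)
import Algebra.Properties.AbelianGroup as AbelianGroupProperties
import Algebra.Properties.CommutativeSemigroup as CommutativeSemigroupProperties
import Algebra.Properties.Group as GroupProperties
open import Data.Bool using (Bool; true; false; not)
open import Data.Fin using (Fin; zero; suc; inject≤; _≟_)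
open import Data.Fin.Properties using (any?; suc-injective; 0≢1+n)
open import Data.Fin.Subset using (Subset; inside; outside; _∈_; _∉_; _⊆_; _⊈_; ⁅_⁆; _∩_; _─_; ∣_∣)
open import Data.Fin.Subset.Properties
open import Data.List using (List; []; _∷_; length; map; filter; tabulate; cartesianProduct)
open import Data.List.Properties using (filter-++; filter-none; length-++; map-tabulate)
open import Data.List.Relation.Unary.All using (All; []; _∷_; universal) renaming (map to mapAll)
import Data.List.Relation.Unary.All.Properties as All
open import Data.List.Relation.Unary.AllPairs using (_∷_)
open import Data.List.Relation.Unary.Unique.Propositional using (Unique)
open import Data.List.Relation.Unary.Unique.DecPropositional.Properties using (deduplicate-!)
open import Data.Nat as ℕ using (ℕ; zero; suc; _≤_; _<_; z≤n; s≤s)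
open import Data.Nat.Properties using (≤-trans; ≤⇒≯)
open import Data.Product using (∃; _×_; _,_; proj₁; proj₂)
open import Data.Sum using (_⊎_; inj₁; inj₂)
open import Data.Vec as Vec using ([]; _∷_; here; there)
import Data.Vec.Properties as Vec
open import Function using (Injective; _⇔_; mk⇔; Equivalence; _∘_)
open import Level using (Level; 0ℓ)
open import Relation.Binary.PropositionalEquality using (_≡_; _≢_; refl; sym; trans; cong; cong₂; subst)
open import Relation.Nullary using (Dec; yes; no; does; ¬_; ¬?; contradiction)
open import Relation.Nullary.Decidable using (dec-true; decidable-stable; _×-dec_)
open import Relation.Unary using (Pred; Decidable)

-- Membership in tabulated subsets and outcomes of deciders.

module _ {n : ℕ} where

  ∈-tabulate⁻ : {f : Fin n → Bool} {i : Fin n} → i ∈ Vec.tabulate f → f i ≡ true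
  ∈-tabulate⁻ {f} {i} i∈ = trans (sym (Vec.lookup∘tabulate f i)) (Vec.[]=⇒lookup i∈)

  ∈-tabulate⁺ : {f : Fin n → Bool} {i : Fin n} → f i ≡ true → i ∈ Vec.tabulate f
  ∈-tabulate⁺ {f} {i} e = Vec.lookup⇒[]= i _ (trans (Vec.lookup∘tabulate f i) e)

does-true : ∀ {p} {P : Set p} (P? : Dec P) → does P? ≡ true → P
does-true (yes p) _ = p

-- The deciders behind _⊕_, differences and ⟨_⟩ are not nameable outside their
-- definitions; P? is implicit here so that unification recovers them.
module _ {n : ℕ} {p : Level} where

  any?⁻ : {P : Pred (Fin n) p} {P? : Decidable P} → does (any? P?) ≡ true → ∃ P
  any?⁻ {P? = P?} = does-true (any? P?)

  any?⁺ : {P : Pred (Fin n) p} {P? : Decidable P} → ∃ P → does (any? P?) ≡ true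
  any?⁺ {P? = P?} = dec-true (any? P?)

  ¬anySubset?⁻ : {P : Pred (Subset n) p} {P? : Decidable P} →
                 not (does (anySubset? P?)) ≡ true → ¬ ∃ P
  ¬anySubset?⁻ {P? = P?} = does-true (¬? (anySubset? P?))

  ¬anySubset?⁺ : {P : Pred (Subset n) p} {P? : Decidable P} →
                 ¬ ∃ P → not (does (anySubset? P?)) ≡ true
  ¬anySubset?⁺ {P? = P?} = dec-true (¬? (anySubset? P?))

-- Counting in finite subsets and lists.

x∈p─q⇒x∉q : ∀ {n} {x : Fin n} (p q : Subset n) → x ∈ p ─ q → x ∉ q
x∈p─q⇒x∉q (_ ∷ p) (outside ∷ q) (there x∈) (there x∈q) = x∈p─q⇒x∉q p q x∈ x∈q
x∈p─q⇒x∉q (_ ∷ p) (inside  ∷ q) (there x∈) (there x∈q) = x∈p─q⇒x∉q p q x∈ x∈q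

-- Induction on `p`: a member `zero` of `p` is paid for by deleting `f zero` from `q`, and
-- injectivity keeps the images of the other members in what remains.
injection⇒∣p∣≤∣q∣ : ∀ {m n} (f : Fin m → Fin n) → Injective _≡_ _≡_ f →
                    (p : Subset m) (q : Subset n) →
                    (∀ {i} → i ∈ p → f i ∈ q) → ∣ p ∣ ≤ ∣ q ∣
injection⇒∣p∣≤∣q∣ f inj []            q f∈ = z≤n
injection⇒∣p∣≤∣q∣ f inj (outside ∷ p) q f∈ =
  injection⇒∣p∣≤∣q∣ (f ∘ suc) (suc-injective ∘ inj) p q (f∈ ∘ there)
injection⇒∣p∣≤∣q∣ f inj (inside  ∷ p) q f∈ = ≤-trans
  (s≤s (injection⇒∣p∣≤∣q∣ (f ∘ suc) (suc-injective ∘ inj) p (q ─ ⁅ f zero ⁆)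
    (λ i∈p → x∈p∧x≢y⇒x∈p-y (f∈ (there i∈p)) (0≢1+n ∘ sym ∘ inj))))
  (x∈p⇒∣p-x∣<∣p∣ (f∈ here))

length-filter-tabulate : ∀ {n a p} {A : Set a} {P : Pred A p} {P? : Decidable P}
                         (f : Fin n → A) (S : Subset n) →
                         (∀ i → P (f i) ⇔ i ∈ S) →
                         length (filter P? (tabulate f)) ≡ ∣ S ∣
length-filter-tabulate f [] _ = refl
length-filter-tabulate {P = P} {P?} f (s ∷ S) P⇔∈ = head s (P⇔∈ zero)
  where
  tail : length (filter P? (tabulate (f ∘ suc))) ≡ ∣ S ∣
  tail = length-filter-tabulate (f ∘ suc) S (λ i →
    mk⇔ (drop-there ∘ Equivalence.to (P⇔∈ (suc i))) (Equivalence.from (P⇔∈ (suc i)) ∘ there))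

  head : ∀ s → P (f zero) ⇔ zero ∈ s ∷ S → length (filter P? (tabulate f)) ≡ ∣ s ∷ S ∣
  head s eq with P? (f zero)
  head inside  eq | yes p = cong suc tail
  head outside eq | yes p = contradiction (Equivalence.to eq p) (λ ())
  head inside  eq | no ¬p = contradiction (Equivalence.from eq here) ¬p
  head outside eq | no ¬p = tail

length-filter-none : ∀ {a p} {A : Set a} {P : Pred A p} {P? : Decidable P}
                     (xs : List A) → (∀ x → ¬ P x) → length (filter P? xs) ≡ 0
length-filter-none {P? = P?} xs ¬P = cong length (filter-none P? (universal ¬P xs))

module _ {a b p q} {A : Set a} {B : Set b} {P : Pred (A × B) p} {P? : Decidable P}
         {Q : Pred A q} (Q? : Decidable Q) where

  -- The product is counted row by row: a row contributes 1 if its first entry satisfies `Q` and 0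
  -- otherwise. In the count `N`, a row is a fixed `a`, which admits at most one `b`.
  length-filter-cartesianProduct :
    (xs : List A) (ys : List B) →
    (∀ x → Q x → length (filter (λ y → P? (x , y)) ys) ≡ 1) →
    (∀ x → ¬ Q x → ∀ y → ¬ P (x , y)) →
    length (filter P? (cartesianProduct xs ys)) ≡ length (filter Q? xs)
  length-filter-cartesianProduct []       ys one none = refl
  length-filter-cartesianProduct (x ∷ xs) ys one none = trans
    (cong length (filter-++ P? (map (x ,_) ys) _))
    (trans (length-++ (filter P? (map (x ,_) ys))) row)
    where
    rest : length (filter P? (cartesianProduct xs ys)) ≡ length (filter Q? xs)
    rest = length-filter-cartesianProduct xs ys one none

    length-filter-row : ∀ ys → length (filter P? (map (x ,_) ys))
                             ≡ length (filter (λ y → P? (x , y)) ys)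
    length-filter-row []       = refl
    length-filter-row (y ∷ ys) with does (P? (x , y))
    ... | true  = cong suc (length-filter-row ys)
    ... | false = length-filter-row ys

    row : length (filter P? (map (x ,_) ys)) ℕ.+ length (filter P? (cartesianProduct xs ys))
        ≡ length (filter Q? (x ∷ xs))
    row with Q? x
    ... | yes q = cong₂ ℕ._+_ (trans (length-filter-row ys) (one x q)) rest
    ... | no ¬q = cong₂ ℕ._+_
      (trans (length-filter-row ys) (length-filter-none ys (none x ¬q))) rest

three-distinct : ∀ {a p} {A : Set a} {P : Pred A p} {xs : List A} →
                 Unique xs → All P xs → 2 < length xs →
                 ∃ λ x → ∃ λ y → ∃ λ z → (P x × P y × P z) × x ≢ y × x ≢ z × y ≢ z
three-distinct ((x≢y ∷ x≢z ∷ _) ∷ (y≢z ∷ _) ∷ _) (px ∷ py ∷ pz ∷ _) _ =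
  _ , _ , _ , (px , py , pz) , x≢y , x≢z , y≢z
three-distinct {xs = _ ∷ []}     _ _ (s≤s ())
three-distinct {xs = _ ∷ _ ∷ []} _ _ (s≤s (s≤s ()))

another-index : ∀ {t} → 2 ≤ t → (i : Fin t) → ∃ λ j → i ≢ j
another-index (s≤s (s≤s z≤n)) zero    = suc zero , λ ()
another-index (s≤s (s≤s z≤n)) (suc i) = zero , λ ()

-- Subsets of a finite abelian group, handled through group elements.

module FiniteGroupSets {c ℓ : Level} (G : FiniteAbelianGroup c ℓ) where

  open Subsets G renaming (refl to ≈-refl; trans to ≈-trans)
  open AbelianGroup abelianGroup
    using (group; commutativeSemigroup; assoc; comm; identityˡ; identityʳ)
  open GroupProperties group
  open AbelianGroupProperties abelianGroup using (xyx⁻¹≈y; ⁻¹-∙-comm; ⁻¹-anti-homo‿-)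
  open CommutativeSemigroupProperties commutativeSemigroup using (interchange)

  from∘to∈ : ∀ {x} S → x ∈ᴳ S → from (to x) ∈ᴳ S
  from∘to∈ S = ∈ᴳ-resp S (≈-sym (strictlyInverseʳ _))

  ⊆-byElements : ∀ {S T} → (∀ x → x ∈ᴳ S → x ∈ᴳ T) → S ⊆ T
  ⊆-byElements {S} {T} S⊆T {i} i∈S =
    subst (_∈ T) (strictlyInverseˡ i) (S⊆T (from i) (subst (_∈ S) (sym (strictlyInverseˡ i)) i∈S))

  ≡-byElements : ∀ {S T} → (∀ x → x ∈ᴳ S → x ∈ᴳ T) → (∀ x → x ∈ᴳ T → x ∈ᴳ S) → S ≡ T
  ≡-byElements S⊆T T⊆S = ⊆-antisym (⊆-byElements S⊆T) (⊆-byElements T⊆S)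

  ∈-⊕⁻ : ∀ S T {x} → x ∈ᴳ S ⊕ T → ∃ λ s → s ∈ᴳ S × ∃ λ t → t ∈ᴳ T × x ≈ s + t
  ∈-⊕⁻ S T x∈ with any?⁻ {n = order} (∈-tabulate⁻ x∈)
  ... | i , s∈ , t , t∈ , e = from i , s∈ , t , t∈ , ≈-trans (≈-sym (strictlyInverseʳ _)) e

  ∈-⊕⁺ : ∀ S T {x s t} → s ∈ᴳ S → t ∈ᴳ T → x ≈ s + t → x ∈ᴳ S ⊕ T
  ∈-⊕⁺ S T {x} {s} {t} s∈ t∈ e = ∈-tabulate⁺ (any?⁺ {n = order}
    (to s , from∘to∈ S s∈ , t , t∈ ,
     ≈-trans (strictlyInverseʳ x) (≈-trans e (∙-congʳ (≈-sym (strictlyInverseʳ s))))))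

  ∈-differences⁻ : ∀ S {z} → z ∈ᴳ differences S →
                   ∃ λ x → x ∈ᴳ S × ∃ λ y → y ∈ᴳ S × z ≈ x - y
  ∈-differences⁻ S z∈ with any?⁻ {n = order} (∈-tabulate⁻ z∈)
  ... | i , x∈ , y , y∈ , e = from i , x∈ , y , y∈ , ≈-trans (≈-sym (strictlyInverseʳ _)) e

  ∈-differences⁺ : ∀ S {x y z} → x ∈ᴳ S → y ∈ᴳ S → z ≈ x - y → z ∈ᴳ differences S
  ∈-differences⁺ S {x} {y} {z} x∈ y∈ e = ∈-tabulate⁺ (any?⁺ {n = order}
    (to x , from∘to∈ S x∈ , y , y∈ ,
     ≈-trans (strictlyInverseʳ z) (≈-trans e (∙-congʳ (≈-sym (strictlyInverseʳ x))))))

  ⟨⟩-minimal : ∀ X {K} → IsSubgroup K → X ⊆ K → ∀ x → x ∈ᴳ ⟨ X ⟩ → x ∈ᴳ K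
  -- Membership in `⟨ X ⟩` is decided as the absence of a `K` violating the defining implication, so
  -- it only refutes `x∉K`; decidability of `_∈ᴳ_` removes the double negation.
  ⟨⟩-minimal X {K} K≤G X⊆K x x∈ = decidable-stable (x ∈ᴳ? K) λ x∉K →
    ¬anySubset?⁻ {n = order} (∈-tabulate⁻ x∈)
      (K , λ x∈K → x∉K (∈ᴳ-resp K (strictlyInverseʳ x) (x∈K (K≤G , X⊆K))))

  ⊆-⟨⟩ : ∀ X x → x ∈ᴳ X → x ∈ᴳ ⟨ X ⟩
  ⊆-⟨⟩ X x x∈X = ∈-tabulate⁺ (¬anySubset?⁺ {n = order}
    λ (K , ¬x∈K) → ¬x∈K λ (_ , X⊆K) → from∘to∈ K (X⊆K x∈X))

  [x-y]+[y-z]≈x-z : ∀ x y z → (x - y) + (y - z) ≈ x - z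
  [x-y]+[y-z]≈x-z x y z = ≈-trans (≈-sym (assoc (x - y) y (- z))) (∙-congʳ (//-rightDividesˡ y x))

  [x-z]-[y-z]≈x-y : ∀ x y z → (x - z) - (y - z) ≈ x - y
  [x-z]-[y-z]≈x-y x y z = ≈-trans (∙-congˡ (⁻¹-anti-homo‿- y z)) ([x-y]+[y-z]≈x-z x z y)

  -- Congruence modulo a subgroup, and its cosets.

  module CosetProperties {K : 𝒫G} (K≤G : IsSubgroup K) where

    0∈ : 0# ∈ᴳ K
    0∈ = proj₁ K≤G

    +∈ : ∀ {x y} → x ∈ᴳ K → y ∈ᴳ K → x + y ∈ᴳ K
    +∈ x∈ y∈ = proj₁ (proj₂ K≤G) _ x∈ _ y∈

    -∈ : ∀ {x} → x ∈ᴳ K → - x ∈ᴳ K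
    -∈ x∈ = proj₂ (proj₂ K≤G) _ x∈

    infix 4 _∼_
    -- Congruence modulo `K`. Its classes are the cosets of `K`, so arguments about cosets become
    -- uses of reflexivity, symmetry and transitivity, without explicit elements `k`.
    _∼_ : Carrier → Carrier → Set
    x ∼ y = x - y ∈ᴳ K

    ∼-reflexive : ∀ {x y} → x ≈ y → x ∼ y
    ∼-reflexive x≈y = ∈ᴳ-resp K (≈-sym (x≈y⇒x∙y⁻¹≈ε x≈y)) 0∈

    ∼-sym : ∀ {x y} → x ∼ y → y ∼ x
    ∼-sym x∼y = ∈ᴳ-resp K (⁻¹-anti-homo‿- _ _) (-∈ x∼y)

    ∼-trans : ∀ {x y z} → x ∼ y → y ∼ z → x ∼ z
    ∼-trans x∼y y∼z = ∈ᴳ-resp K ([x-y]+[y-z]≈x-z _ _ _) (+∈ x∼y y∼z)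

    ∼-translate : ∀ {x y} z → x ∼ y → x - z ∼ y - z
    ∼-translate z = ∈ᴳ-resp K (≈-sym ([x-z]-[y-z]≈x-y _ _ z))

    ∈⇒∼ : ∀ {x y} → x ∈ᴳ K → y ∈ᴳ K → x ∼ y
    ∈⇒∼ x∈ y∈ = +∈ x∈ (-∈ y∈)

    ∼-∈ : ∀ {x y} → x ∼ y → x ∈ᴳ K → y ∈ᴳ K
    ∼-∈ x∼y x∈ = ∈ᴳ-resp K (//-rightDividesˡ _ _) (+∈ (∼-sym x∼y) x∈)

    ∈-+ˢ⁻ : ∀ {g x} → x ∈ᴳ g +ˢ K → x ∼ g
    ∈-+ˢ⁻ {g} {x} x∈ with does-true (inCoset? g K (from (to x))) (∈-tabulate⁻ x∈)
    ... | k , k∈ , e = ∈ᴳ-resp K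
      (≈-sym (≈-trans (∙-congʳ (≈-trans (≈-sym (strictlyInverseʳ x)) e)) (xyx⁻¹≈y g k))) k∈

    ∈-+ˢ⁺ : ∀ {g x} → x ∼ g → x ∈ᴳ g +ˢ K
    ∈-+ˢ⁺ {g} {x} x∼g = ∈-tabulate⁺ (dec-true (inCoset? g K (from (to x)))
      (x - g , x∼g , ≈-trans (strictlyInverseʳ x)
        (≈-trans (≈-sym (//-rightDividesˡ g x)) (comm (x - g) g))))

    ∈-+ˢ-self : ∀ g → g ∈ᴳ g +ˢ K
    ∈-+ˢ-self g = ∈-+ˢ⁺ (∼-reflexive ≈-refl)

    coset-∼ : ∀ {S x y} → IsCoset K S → x ∈ᴳ S → y ∈ᴳ S → x ∼ y
    coset-∼ (g , refl) x∈ y∈ = ∼-trans (∈-+ˢ⁻ x∈) (∼-sym (∈-+ˢ⁻ y∈))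

    coset-closed : ∀ {S x y} → IsCoset K S → x ∼ y → x ∈ᴳ S → y ∈ᴳ S
    coset-closed (g , refl) x∼y x∈ = ∈-+ˢ⁺ (∼-trans (∼-sym x∼y) (∈-+ˢ⁻ x∈))

    coset-unique : ∀ {S T x} → IsCoset K S → IsCoset K T → x ∈ᴳ S → x ∈ᴳ T → S ≡ T
    coset-unique cS cT x∈S x∈T = ≡-byElements
      (λ y y∈S → coset-closed cT (coset-∼ cS x∈S y∈S) x∈T)
      (λ y y∈T → coset-closed cS (coset-∼ cT x∈T y∈T) x∈S)

    self-isCoset : IsCoset K K
    self-isCoset = 0# , ≡-byElements
      (λ x x∈ → ∈-+ˢ⁺ (∈⇒∼ x∈ 0∈)) (λ x x∈ → ∼-∈ (∼-sym (∈-+ˢ⁻ x∈)) 0∈)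

    +ˢ-cong : ∀ {g h} → g ∼ h → g +ˢ K ≡ h +ˢ K
    +ˢ-cong {g} {h} g∼h = coset-unique (g , refl) (h , refl) (∈-+ˢ-self g) (∈-+ˢ⁺ g∼h)

    coset-⊆ : ∀ {P : 𝒫G} {g} → (∀ {x y} → x ∼ y → x ∈ᴳ P → y ∈ᴳ P) → g ∈ᴳ P → g +ˢ K ⊆ P
    coset-⊆ closed g∈ = ⊆-byElements λ x x∈ → closed (∼-sym (∈-+ˢ⁻ x∈)) g∈

    -- Translation by `g` is injective and carries `K` into `g +ˢ K`.
    ∣K∣≤∣coset∣ : ∀ {S} → IsCoset K S → ∣ K ∣ ≤ ∣ S ∣
    ∣K∣≤∣coset∣ (g , refl) = injection⇒∣p∣≤∣q∣ (λ i → to (g + from i))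
      (λ {i} {j} e → trans (sym (strictlyInverseˡ i))
        (trans (to-cong (∙-cancelˡ g _ _ (to-injective e))) (strictlyInverseˡ j)))
      K (g +ˢ K)
      (λ {i} i∈ → ∈-+ˢ⁺ (∈ᴳ-resp K (≈-sym (xyx⁻¹≈y g (from i)))
        (subst (_∈ K) (sym (strictlyInverseˡ i)) i∈)))

    -- All differences of `S` lie in the subgroup `K`, hence so does what they generate. This serves
    -- both `A i` with `K` = `H i` and the cosets of `D` with `K` = `D`.
    idg-⊆ : ∀ S → (∀ {x y} → x ∈ᴳ S → y ∈ᴳ S → x ∼ y) →
            ∀ x → x ∈ᴳ internalDifferenceGroup S → x ∈ᴳ K
    idg-⊆ S S∼S = ⟨⟩-minimal (differences S) K≤G (⊆-byElements λ z z∈ →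
      let _ , x∈ , _ , y∈ , z≈x-y = ∈-differences⁻ S z∈
      in ∈ᴳ-resp K (≈-sym z≈x-y) (S∼S x∈ y∈))

    -- The index is the length of a duplicate-free list of cosets, so three of its entries are
    -- distinct; their representatives are incongruent because congruent elements have equal cosets.
    three-incongruent : ∀ L → 2 < ∣ L ∶ K ∣ →
      ∃ λ x → ∃ λ y → ∃ λ z → (x ∈ᴳ L × y ∈ᴳ L × z ∈ᴳ L) × ¬ x ∼ y × ¬ x ∼ z × ¬ y ∼ z
    three-incongruent L 2<L:K
      with three-distinct
             (deduplicate-! _≟ˢ_ (map (_+ˢ K) (filter (_∈ᴳ? L) elements)))
             -- Each listed coset keeps a representative in `L`, also after deduplication.
             (All.deduplicate⁺ _≟ˢ_ {P = λ S → ∃ λ x → x ∈ᴳ L × S ≡ x +ˢ K}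
               (All.map⁺ (mapAll (λ x∈ → _ , x∈ , refl) (All.all-filter (_∈ᴳ? L) elements))))
             2<L:K
    ... | _ , _ , _ , ((x , x∈ , refl) , (y , y∈ , refl) , (z , z∈ , refl)) , x≢y , x≢z , y≢z =
      x , y , z , (x∈ , y∈ , z∈) , x≢y ∘ +ˢ-cong , x≢z ∘ +ˢ-cong , y≢z ∘ +ˢ-cong

    -- Among three pairwise incongruent elements at most one lies in `K` and at most one in the
    -- coset of `h`, so one is left over. This is where index greater than 2 enters.
    avoid-two-cosets : ∀ L → 2 < ∣ L ∶ K ∣ → ∀ h →
                       ∃ λ y → y ∈ᴳ L × ¬ y ∈ᴳ K × ¬ y ∼ h
    avoid-two-cosets L 2<L:K h with three-incongruent L 2<L:K
    ... | x , y , z , (x∈ , y∈ , z∈) , x≁y , x≁z , y≁z =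
      pigeonhole (classify x) (classify y) (classify z)
      where
      Avoids : Carrier → Set
      Avoids x = ¬ x ∈ᴳ K × ¬ x ∼ h

      classify : ∀ x → Avoids x ⊎ x ∈ᴳ K ⊎ x ∼ h
      classify x with x ∈ᴳ? K | x - h ∈ᴳ? K
      ... | yes x∈K | _       = inj₂ (inj₁ x∈K)
      ... | no _    | yes x∼h = inj₂ (inj₂ x∼h)
      ... | no x∉K  | no x≁h  = inj₁ (x∉K , x≁h)

      via-h : ∀ {x y} → x ∼ h → y ∼ h → x ∼ y
      via-h x∼h y∼h = ∼-trans x∼h (∼-sym y∼h)

      pigeonhole : Avoids x ⊎ x ∈ᴳ K ⊎ x ∼ h → Avoids y ⊎ y ∈ᴳ K ⊎ y ∼ h →
                   Avoids z ⊎ z ∈ᴳ K ⊎ z ∼ h → ∃ λ y → y ∈ᴳ L × Avoids y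
      pigeonhole (inj₁ a) _ _ = x , x∈ , a
      pigeonhole _ (inj₁ a) _ = y , y∈ , a
      pigeonhole _ _ (inj₁ a) = z , z∈ , a
      -- If none of the three avoids both cosets, two share one of them and are congruent.
      pigeonhole (inj₂ (inj₁ p)) (inj₂ (inj₁ q)) _ = contradiction (∈⇒∼ p q) x≁y
      pigeonhole (inj₂ (inj₂ p)) (inj₂ (inj₂ q)) _ = contradiction (via-h p q) x≁y
      pigeonhole (inj₂ (inj₁ p)) _ (inj₂ (inj₁ r)) = contradiction (∈⇒∼ p r) x≁z
      pigeonhole (inj₂ (inj₂ p)) _ (inj₂ (inj₂ r)) = contradiction (via-h p r) x≁z
      pigeonhole _ (inj₂ (inj₁ q)) (inj₂ (inj₁ r)) = contradiction (∈⇒∼ q r) y≁z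
      pigeonhole _ (inj₂ (inj₂ q)) (inj₂ (inj₂ r)) = contradiction (via-h q r) y≁z

  x-[x-y]≈y : ∀ x y → x - (x - y) ≈ y
  x-[x-y]≈y x y = ≈-trans (∙-congˡ (⁻¹-anti-homo‿- x y))
    (≈-trans (≈-sym (assoc x y (- x))) (xyx⁻¹≈y x y))

  -- Sums and unions of families of subgroups.

  ∈-zero⁻ : ∀ {x} → x ∈ᴳ ⟦ _≈? 0# ⟧ → x ≈ 0#
  ∈-zero⁻ {x} x∈ = ≈-trans (≈-sym (strictlyInverseʳ x))
    (does-true (from (to x) ≈? 0#) (∈-tabulate⁻ x∈))

  ∈-zero⁺ : ∀ {x} → x ≈ 0# → x ∈ᴳ ⟦ _≈? 0# ⟧
  ∈-zero⁺ {x} x≈0 = ∈-tabulate⁺ (dec-true (from (to x) ≈? 0#) (≈-trans (strictlyInverseʳ x) x≈0))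

  zero-isSubgroup : IsSubgroup ⟦ _≈? 0# ⟧
  zero-isSubgroup = ∈-zero⁺ ≈-refl
    , (λ x x∈ y y∈ → ∈-zero⁺ (≈-trans (∙-congʳ (∈-zero⁻ x∈)) (≈-trans (identityˡ y) (∈-zero⁻ y∈))))
    , (λ x x∈ → ∈-zero⁺ (≈-trans (⁻¹-cong (∈-zero⁻ x∈)) ε⁻¹≈ε))

  ⊕-isSubgroup : ∀ {S T} → IsSubgroup S → IsSubgroup T → IsSubgroup (S ⊕ T)
  ⊕-isSubgroup {S} {T} S≤G T≤G = ∈-⊕⁺ S T S.0∈ T.0∈ (≈-sym (identityˡ 0#)) , closed , closed⁻
    where
    module S = CosetProperties S≤G
    module T = CosetProperties T≤G

    closed : ∀ x → x ∈ᴳ S ⊕ T → ∀ y → y ∈ᴳ S ⊕ T → x + y ∈ᴳ S ⊕ T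
    closed x x∈ y y∈ with ∈-⊕⁻ S T x∈ | ∈-⊕⁻ S T y∈
    ... | s , s∈ , t , t∈ , x≈s+t | s′ , s′∈ , t′ , t′∈ , y≈s′+t′ =
      ∈-⊕⁺ S T (S.+∈ s∈ s′∈) (T.+∈ t∈ t′∈)
        (≈-trans (≈-trans (∙-congʳ x≈s+t) (∙-congˡ y≈s′+t′)) (interchange s t s′ t′))

    closed⁻ : ∀ x → x ∈ᴳ S ⊕ T → - x ∈ᴳ S ⊕ T
    closed⁻ x x∈ with ∈-⊕⁻ S T x∈
    ... | s , s∈ , t , t∈ , x≈s+t = ∈-⊕⁺ S T (S.-∈ s∈) (T.-∈ t∈)
      (≈-trans (⁻¹-cong x≈s+t) (≈-sym (⁻¹-∙-comm s t)))

  sumOf-isSubgroup : ∀ {t} (H : Fin t → 𝒫G) → (∀ i → IsSubgroup (H i)) → IsSubgroup (sumOf H)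
  sumOf-isSubgroup {zero}  H H≤G = zero-isSubgroup
  sumOf-isSubgroup {suc t} H H≤G =
    ⊕-isSubgroup (H≤G zero) (sumOf-isSubgroup (H ∘ suc) (H≤G ∘ suc))

  ∈-sumOf : ∀ {t} (H : Fin t → 𝒫G) → (∀ i → IsSubgroup (H i)) →
            ∀ i {x} → x ∈ᴳ H i → x ∈ᴳ sumOf H
  ∈-sumOf H H≤G zero {x} x∈ = ∈-⊕⁺ (H zero) (sumOf (H ∘ suc)) x∈
    (proj₁ (sumOf-isSubgroup (H ∘ suc) (H≤G ∘ suc))) (≈-sym (identityʳ x))
  ∈-sumOf H H≤G (suc i) {x} x∈ = ∈-⊕⁺ (H zero) (sumOf (H ∘ suc)) (proj₁ (H≤G zero))
    (∈-sumOf (H ∘ suc) (H≤G ∘ suc) i x∈) (≈-sym (identityˡ x))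

  ∈-unionOf⁻ : ∀ {t} (H : Fin t → 𝒫G) {x} → x ∈ᴳ unionOf H → ∃ λ i → x ∈ᴳ H i
  ∈-unionOf⁻ {zero}  H x∈ = contradiction x∈ ∉⊥
  ∈-unionOf⁻ {suc t} H x∈ with x∈p∪q⁻ (H zero) (unionOf (H ∘ suc)) x∈
  ... | inj₁ x∈H₀ = zero , x∈H₀
  ... | inj₂ x∈   = let i , x∈Hᵢ = ∈-unionOf⁻ (H ∘ suc) x∈ in suc i , x∈Hᵢ

  ∈-unionOf⁺ : ∀ {t} (H : Fin t → 𝒫G) i {x} → x ∈ᴳ H i → x ∈ᴳ unionOf H
  ∈-unionOf⁺ H zero    x∈ = x∈p∪q⁺ (inj₁ x∈)
  ∈-unionOf⁺ H (suc i) x∈ = x∈p∪q⁺ {p = H zero} (inj₂ (∈-unionOf⁺ (H ∘ suc) i x∈))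

  -- Counting pairs with a given difference.

  elements≡tabulate : elements ≡ tabulate from
  elements≡tabulate = map-tabulate (λ i → i) from

  length-filter-elements : ∀ {p} {P : Pred Carrier p} {P? : Decidable P} (S : 𝒫G) →
                           (∀ i → P (from i) ⇔ i ∈ S) → length (filter P? elements) ≡ ∣ S ∣
  length-filter-elements {P? = P?} S P⇔∈ =
    trans (cong (length ∘ filter P?) elements≡tabulate) (length-filter-tabulate from S P⇔∈)

  module PairCount {a} {𝒜 : Pred 𝒫G a} (𝒜? : Decidable 𝒜) (S : 𝒫G) where

    -- The condition that `N` places on `b`, copied in the same form so that the count there unfolds
    -- to it.
    InOther : Pred Carrier a
    InOther b = ∃ λ T → 𝒜 T × T ≢ S × b ∈ᴳ T

    InOther-resp : ∀ {x y} → x ≈ y → InOther x → InOther y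
    InOther-resp x≈y (T , T∈ , T≢S , x∈T) = T , T∈ , T≢S , ∈ᴳ-resp T x≈y x∈T

    inOther? : Decidable InOther
    inOther? b = anySubset? λ T → 𝒜? T ×-dec ¬? (T ≟ˢ S) ×-dec (b ∈ᴳ? T)

    -- Each `x` in `S` has exactly one partner, namely `x - δ`, so its row of pairs is counted by
    -- the singleton of `x - δ`.
    N≡∣S∣ : ∀ δ → (∀ x → x ∈ᴳ S → InOther (x - δ)) → N 𝒜? S δ ≡ ∣ S ∣
    N≡∣S∣ δ all = trans
      (length-filter-cartesianProduct (_∈ᴳ? S) elements elements
        (λ x x∈S → trans (length-filter-elements ⁅ to (x - δ) ⁆ (unique x x∈S))
                         (∣⁅x⁆∣≡1 (to (x - δ))))
        (λ x x∉S y (x∈S , _) → x∉S x∈S))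
      (length-filter-elements S (λ i →
        mk⇔ (subst (_∈ S) (strictlyInverseˡ i)) (subst (_∈ S) (sym (strictlyInverseˡ i)))))
      where
      unique : ∀ x → x ∈ᴳ S → ∀ i →
               (x ∈ᴳ S × InOther (from i) × x - from i ≈ δ) ⇔ i ∈ ⁅ to (x - δ) ⁆
      unique x x∈S i = mk⇔
        (λ (_ , _ , e) → Equivalence.from x∈⁅y⁆⇔x≡y
          (trans (sym (strictlyInverseˡ i))
                 (to-cong (≈-trans (≈-sym (x-[x-y]≈y x (from i))) (∙-congˡ (⁻¹-cong e))))))
        (λ i∈ → let e = from≈ (x∈⁅y⁆⇒x≡y _ i∈) in
          x∈S , InOther-resp (≈-sym e) (all x x∈S) ,
          ≈-trans (∙-congˡ (⁻¹-cong e)) (x-[x-y]≈y x δ))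
        where
        from≈ : i ≡ to (x - δ) → from i ≈ x - δ
        from≈ refl = strictlyInverseʳ (x - δ)

    N≡0 : ∀ δ → (∀ x → x ∈ᴳ S → ¬ InOther (x - δ)) → N 𝒜? S δ ≡ 0
    N≡0 δ none = length-filter-none (cartesianProduct elements elements)
      λ (x , y) (x∈S , other , x-y≈δ) → none x x∈S (InOther-resp
        (≈-trans (≈-sym (x-[x-y]≈y x y)) (∙-congˡ (⁻¹-cong x-y≈δ))) other)

    -- A finite search decides whether some member of `S` has a partner. If one has, uniformity
    -- gives a partner to all of them; otherwise no pair is counted.
    N-uniform : ∀ δ → (∀ {x y} → x ∈ᴳ S → y ∈ᴳ S → InOther (x - δ) → InOther (y - δ)) →
                N 𝒜? S δ ≡ 0 ⊎ N 𝒜? S δ ≡ ∣ S ∣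
    N-uniform δ uniform with any? (λ i → (from i ∈ᴳ? S) ×-dec inOther? (from i - δ))
    ... | yes (i , i∈S , other) = inj₂ (N≡∣S∣ δ λ x x∈S → uniform i∈S x∈S other)
    ... | no none = inj₁ (N≡0 δ λ x x∈S other → none
      (to x , from∘to∈ S x∈S , InOther-resp (∙-congʳ (≈-sym (strictlyInverseʳ x))) other))

  -- The collection and its disjointness.

  module Configuration
    {t : ℕ} (2≤t : 2 ≤ t) {H : Fin t → 𝒫G} {D : 𝒫G}
    (H≤G : ∀ i → IsSubgroup (H i)) (D≤G : IsSubgroup D)
    (H∩H≡D : ∀ i j → i ≢ j → H i ∩ H j ≡ D)
    (2<∣H∶D∣ : ∀ i → 2 < ∣ H i ∶ D ∣)
    {𝒞 : Pred 𝒫G 0ℓ} (𝒞? : Decidable 𝒞)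
    (𝒞-cosets : ∀ C → 𝒞 C → IsCoset (sumOf H) C × C ≢ sumOf H)
    where

    open Construction H D 𝒞?

    i₀ : Fin t
    i₀ = inject≤ zero 2≤t

    ΣH : 𝒫G
    ΣH = sumOf H

    module Dₘ = CosetProperties D≤G
    module Hₘ (i : Fin t) = CosetProperties (H≤G i)
    module Σₘ = CosetProperties (sumOf-isSubgroup H H≤G)

    H⊆ΣH : ∀ i {x} → x ∈ᴳ H i → x ∈ᴳ ΣH
    H⊆ΣH = ∈-sumOf H H≤G

    -- As `t` is at least 2, some `j` differs from `i`, and `D` is `H i ∩ H j`.
    D⊆H : ∀ i {x} → x ∈ᴳ D → x ∈ᴳ H i
    D⊆H i {x} x∈D = let j , i≢j = another-index 2≤t i in
      proj₁ (x∈p∩q⁻ (H i) (H j) (subst (to x ∈_) (sym (H∩H≡D i j i≢j)) x∈D))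

    D⊆ΣH : ∀ {x} → x ∈ᴳ D → x ∈ᴳ ΣH
    D⊆ΣH x∈D = H⊆ΣH i₀ (D⊆H i₀ x∈D)

    -- A coset of `ΣH` that meets `ΣH` is equal to it, which is excluded for members of `𝒞`.
    𝒞-avoids-ΣH : ∀ {C x} → 𝒞 C → x ∈ᴳ C → ¬ x ∈ᴳ ΣH
    𝒞-avoids-ΣH C∈ x∈C x∈Σ = let C-coset , C≢Σ = 𝒞-cosets _ C∈ in
      C≢Σ (Σₘ.coset-unique C-coset Σₘ.self-isCoset x∈C x∈Σ)

    𝒞-closed : ∀ {C x y} → 𝒞 C → Σₘ._∼_ x y → x ∈ᴳ C → y ∈ᴳ C
    𝒞-closed C∈ = Σₘ.coset-closed (proj₁ (𝒞-cosets _ C∈))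

    ∈A⁺ : ∀ i {x} → x ∈ᴳ H i → ¬ x ∈ᴳ D → x ∈ᴳ A i
    ∈A⁺ i = x∈p∧x∉q⇒x∈p─q

    A⊆H : ∀ i {x} → x ∈ᴳ A i → x ∈ᴳ H i
    A⊆H i = p─q⊆p (H i) D

    A-avoids-D : ∀ i {x} → x ∈ᴳ A i → ¬ x ∈ᴳ D
    A-avoids-D i = x∈p─q⇒x∉q (H i) D

    -- Since `D` lies in `H i`, a coset of `D` with one point in `H i` lies entirely in `H i`. Not
    -- being contained in the union therefore already means being disjoint from it.
    new-coset-avoids-H : ∀ {S x} → IsCoset D S → S ⊈ unionOf H → x ∈ᴳ S → ∀ i → ¬ x ∈ᴳ H i
    new-coset-avoids-H S-coset S⊈∪ x∈S i x∈Hᵢ = S⊈∪ (⊆-byElements λ y y∈S →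
      ∈-unionOf⁺ H i (Hₘ.∼-∈ i (D⊆H i (Dₘ.coset-∼ S-coset x∈S y∈S)) x∈Hᵢ))

    -- A point common to two different `A i` and `A j` would lie in `H i ∩ H j`, which is the
    -- removed `D`. Members of the other two kinds miss `H i` altogether.
    A-only : ∀ i {S x} → 𝒜 S → x ∈ᴳ A i → x ∈ᴳ S → S ≡ A i
    A-only i {x = x} (inj₁ (j , refl)) x∈Aᵢ x∈Aⱼ with i ≟ j
    ... | yes refl = refl
    ... | no i≢j = contradiction
      (subst (to x ∈_) (H∩H≡D i j i≢j) (x∈p∩q⁺ (A⊆H i x∈Aᵢ , A⊆H j x∈Aⱼ))) (A-avoids-D i x∈Aᵢ)
    A-only i (inj₂ (inj₁ (S-coset , _ , S⊈∪))) x∈Aᵢ x∈S =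
      contradiction (A⊆H i x∈Aᵢ) (new-coset-avoids-H S-coset S⊈∪ x∈S i)
    A-only i (inj₂ (inj₂ (_ , C , C∈ , S⊆C))) x∈Aᵢ x∈S =
      contradiction (H⊆ΣH i (A⊆H i x∈Aᵢ)) (𝒞-avoids-ΣH C∈ (S⊆C x∈S))

    A-or-coset : ∀ {S} → 𝒜 S → (∃ λ i → S ≡ A i) ⊎ IsCoset D S
    A-or-coset (inj₁ S≡A)                     = inj₁ S≡A
    A-or-coset (inj₂ (inj₁ (S-coset , _)))    = inj₂ S-coset
    A-or-coset (inj₂ (inj₂ (S-coset , _)))    = inj₂ S-coset

    𝒜-unique : ∀ {S T x} → 𝒜 S → 𝒜 T → x ∈ᴳ S → x ∈ᴳ T → S ≡ T
    𝒜-unique S∈ T∈ x∈S x∈T with A-or-coset S∈ | A-or-coset T∈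
    ... | inj₁ (i , refl) | _               = sym (A-only i T∈ x∈S x∈T)
    ... | inj₂ _          | inj₁ (j , refl) = A-only j S∈ x∈T x∈S
    ... | inj₂ S-coset    | inj₂ T-coset    = Dₘ.coset-unique S-coset T-coset x∈S x∈T

    pairwiseDisjoint : PairwiseDisjoint 𝒜
    pairwiseDisjoint S T S∈ T∈ S≢T (i , i∈S∩T) = S≢T (𝒜-unique S∈ T∈
      (subst (_∈ S) (sym (strictlyInverseˡ i)) i∈S) (subst (_∈ T) (sym (strictlyInverseˡ i)) i∈T))
      where
      i∈S = proj₁ (x∈p∩q⁻ S T i∈S∩T)
      i∈T = proj₂ (x∈p∩q⁻ S T i∈S∩T)

    -- The union of the collection.

    Covered : Pred Carrier c
    Covered x = ∃ λ S → 𝒜 S × x ∈ᴳ S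

    InChosenCoset : Pred Carrier 0ℓ
    InChosenCoset x = ∃ λ C → 𝒞 C × x ∈ᴳ C

    Covered⁻ : ∀ {x} → Covered x → (x ∈ᴳ ΣH × ¬ x ∈ᴳ D) ⊎ InChosenCoset x
    Covered⁻ (_ , inj₁ (i , refl) , x∈) = inj₁ (H⊆ΣH i (A⊆H i x∈) , A-avoids-D i x∈)
    Covered⁻ (_ , inj₂ (inj₁ (S-coset , S⊆Σ , S⊈∪)) , x∈) =
      inj₁ (S⊆Σ x∈ , λ x∈D → new-coset-avoids-H S-coset S⊈∪ x∈ i₀ (D⊆H i₀ x∈D))
    Covered⁻ (_ , inj₂ (inj₂ (_ , C , C∈ , S⊆C)) , x∈) = inj₂ (C , C∈ , S⊆C x∈)

    -- A point of `ΣH` outside `D` lies in `A i` if some `H i` contains it; otherwise its coset of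
    -- `D` is a member of the second kind. A point of a chosen coset is covered by its own coset of
    -- `D`.
    Covered⁺ : ∀ {x} → (x ∈ᴳ ΣH × ¬ x ∈ᴳ D) ⊎ InChosenCoset x → Covered x
    Covered⁺ {x} (inj₁ (x∈Σ , x∉D)) with any? (λ i → x ∈ᴳ? H i)
    ... | yes (i , x∈Hᵢ) = A i , inj₁ (i , refl) , ∈A⁺ i x∈Hᵢ x∉D
    ... | no x∉H = x +ˢ D , inj₂ (inj₁ ((x , refl) , x+D⊆Σ , x+D⊈∪)) , Dₘ.∈-+ˢ-self x
      where
      x+D⊆Σ : x +ˢ D ⊆ ΣH
      x+D⊆Σ = Dₘ.coset-⊆ (λ y∼z → Σₘ.∼-∈ (D⊆ΣH y∼z)) x∈Σ
      x+D⊈∪ : x +ˢ D ⊈ unionOf H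
      x+D⊈∪ ⊆∪ = x∉H (∈-unionOf⁻ H (⊆∪ (Dₘ.∈-+ˢ-self x)))
    Covered⁺ {x} (inj₂ (C , C∈ , x∈C)) =
      x +ˢ D , inj₂ (inj₂ ((x , refl) , C , C∈ , Dₘ.coset-⊆ (λ y∼z → 𝒞-closed C∈ (D⊆ΣH y∼z)) x∈C)) ,
      Dₘ.∈-+ˢ-self x

    -- `D` is contained in `ΣH`, so `ΣH`, its complement part `D` and the chosen cosets are all
    -- unions of cosets of `D`.
    Covered-closed : ∀ {x y} → Dₘ._∼_ x y → Covered x → Covered y
    Covered-closed x∼y cov = Covered⁺ (closed x∼y (Covered⁻ cov))
      where
      closed : ∀ {x y} → Dₘ._∼_ x y → (x ∈ᴳ ΣH × ¬ x ∈ᴳ D) ⊎ InChosenCoset x →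
               (y ∈ᴳ ΣH × ¬ y ∈ᴳ D) ⊎ InChosenCoset y
      closed x∼y (inj₁ (x∈Σ , x∉D)) =
        inj₁ (Σₘ.∼-∈ (D⊆ΣH x∼y) x∈Σ , x∉D ∘ Dₘ.∼-∈ (Dₘ.∼-sym x∼y))
      closed x∼y (inj₂ (C , C∈ , x∈C)) = inj₂ (C , C∈ , 𝒞-closed C∈ (D⊆ΣH x∼y) x∈C)

    -- If `x` is in `ΣH` but in neither `D` nor `A i`, it is outside `H i`; its coset of `H i` then
    -- misses `H i`, hence `D`, and stays in `ΣH`. If `x` is in a chosen coset, that coset absorbs
    -- `H i` and is disjoint from `ΣH`, which contains `A i`.
    Covered-closed-off-H : ∀ i {x y} → Hₘ._∼_ i x y → Covered x → ¬ x ∈ᴳ A i →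
                           Covered y × ¬ y ∈ᴳ A i
    Covered-closed-off-H i {x} {y} x∼y cov x∉Aᵢ with Covered⁻ cov
    ... | inj₁ (x∈Σ , x∉D) = Covered⁺ (inj₁ (Σₘ.∼-∈ (H⊆ΣH i x∼y) x∈Σ , y∉H ∘ D⊆H i)) , y∉H ∘ A⊆H i
      where
      y∉H : ¬ y ∈ᴳ H i
      y∉H y∈H = x∉Aᵢ (∈A⁺ i (Hₘ.∼-∈ i (Hₘ.∼-sym i x∼y) y∈H) x∉D)
    ... | inj₂ (C , C∈ , x∈C) = Covered⁺ (inj₂ (C , C∈ , y∈C)) , 𝒞-avoids-ΣH C∈ y∈C ∘ H⊆ΣH i ∘ A⊆H i
      where
      y∈C : y ∈ᴳ C
      y∈C = 𝒞-closed C∈ (H⊆ΣH i x∼y) x∈C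

    -- Bimodality and internal difference groups.

    module _ {S : 𝒫G} (S∈ : 𝒜 S) where

      open PairCount 𝒜? S

      -- By disjointness, a point of a member other than `S` cannot also lie in `S`.
      InOther⇒Covered∖S : ∀ {x} → InOther x → Covered x × ¬ x ∈ᴳ S
      InOther⇒Covered∖S (T , T∈ , T≢S , x∈T) =
        (T , T∈ , x∈T) , λ x∈S → T≢S (𝒜-unique T∈ S∈ x∈T x∈S)

      Covered∖S⇒InOther : ∀ {x} → Covered x × ¬ x ∈ᴳ S → InOther x
      Covered∖S⇒InOther ((T , T∈ , x∈T) , x∉S) =
        T , T∈ , (λ T≡S → x∉S (subst (_ ∈ᴳ_) T≡S x∈T)) , x∈T

      -- `x` and `y` are congruent modulo `H i` or modulo `D`, according to the kind of `S`, and so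
      -- are `x - δ` and `y - δ`; the matching closure property of the union applies.
      InOther-uniform : ∀ δ {x y} → x ∈ᴳ S → y ∈ᴳ S → InOther (x - δ) → InOther (y - δ)
      InOther-uniform δ x∈S y∈S other with A-or-coset S∈ | InOther⇒Covered∖S other
      ... | inj₁ (i , refl) | cov , x-δ∉S = Covered∖S⇒InOther (Covered-closed-off-H i
        (Hₘ.∼-translate i δ (Hₘ.∈⇒∼ i (A⊆H i x∈S) (A⊆H i y∈S))) cov x-δ∉S)
      -- If `y - δ` were in the coset `S`, the congruent `x - δ` would be too.
      ... | inj₂ S-coset | cov , x-δ∉S = Covered∖S⇒InOther
        (Covered-closed x∼y cov , x-δ∉S ∘ Dₘ.coset-closed S-coset (Dₘ.∼-sym x∼y))
        where
        x∼y = Dₘ.∼-translate δ (Dₘ.coset-∼ S-coset x∈S y∈S)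

    bimodal : Bimodal 𝒜?
    bimodal S S∈ δ _ = PairCount.N-uniform 𝒜? S δ (InOther-uniform S∈ δ)

    -- For y in H i outside D and h + D, h = y - (y - h) with both terms in A i;
    -- such a y exists because the index exceeds 2.
    idg-A : ∀ i → internalDifferenceGroup (A i) ≡ H i
    idg-A i = ≡-byElements
      (Hₘ.idg-⊆ i (A i) (λ x∈ y∈ → Hₘ.∈⇒∼ i (A⊆H i x∈) (A⊆H i y∈)))
      (λ h h∈ → let y , y∈ , y∉D , y≁h = Dₘ.avoid-two-cosets (H i) (2<∣H∶D∣ i) h in
        ⊆-⟨⟩ (differences (A i)) h (∈-differences⁺ (A i)
          (∈A⁺ i y∈ y∉D) (∈A⁺ i (Hₘ.∈⇒∼ i y∈ h∈) y≁h) (≈-sym (x-[x-y]≈y y h))))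

    -- `A i` arises from its difference group `H i` by removing `D`, which contains `0#`, so it is
    -- strictly smaller. A coset of `D` has its difference group inside `D`, whose order is at most
    -- that of the coset.
    small-members : ∀ S → (𝒜 S × ∣ S ∣ < ∣ internalDifferenceGroup S ∣) ⇔ (∃ λ i → S ≡ A i)
    small-members S = mk⇔ only-A A-small
      where
      A-small : (∃ λ i → S ≡ A i) → 𝒜 S × ∣ S ∣ < ∣ internalDifferenceGroup S ∣
      A-small (i , refl) = inj₁ (i , refl) , subst (λ K → ∣ A i ∣ < ∣ K ∣) (sym (idg-A i))
        (p∩q≢∅⇒∣p─q∣<∣p∣ (H i) D (to 0# , x∈p∩q⁺ (Hₘ.0∈ i , Dₘ.0∈)))

      only-A : 𝒜 S × ∣ S ∣ < ∣ internalDifferenceGroup S ∣ → ∃ λ i → S ≡ A i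
      only-A (S∈ , small) with A-or-coset S∈
      ... | inj₁ S≡A = S≡A
      ... | inj₂ S-coset = contradiction small (≤⇒≯ (≤-trans
        (p⊆q⇒∣p∣≤∣q∣ (⊆-byElements (Dₘ.idg-⊆ S (Dₘ.coset-∼ S-coset))))
        (Dₘ.∣K∣≤∣coset∣ S-coset)))

    H─A≡D : ∀ i → H i ─ A i ≡ D
    H─A≡D i = ≡-byElements
      (λ x x∈ → decidable-stable (x ∈ᴳ? D) λ x∉D →
        x∈p─q⇒x∉q (H i) (A i) x∈ (∈A⁺ i (p─q⊆p (H i) (A i) x∈) x∉D))
      (λ x x∈D → x∈p∧x∉q⇒x∈p─q (D⊆H i x∈D) (λ x∈A → A-avoids-D i x∈A x∈D))

theorem3p11 :
  ∀ {c ℓ : Level} (G : FiniteAbelianGroup c ℓ) →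
  let open Subsets G in
  (t : ℕ) → 2 ≤ t →
  (H : Fin t → 𝒫G) (D : 𝒫G) →
  (∀ i → IsSubgroup (H i)) → IsSubgroup D →
  Injective _≡_ _≡_ H →
  (∀ i j → i ≢ j → H i ∩ H j ≡ D) →
  (∀ i → 2 < ∣ H i ∶ D ∣) →
  (𝒞 : Pred 𝒫G 0ℓ) (𝒞? : Decidable 𝒞) →
  (∀ C → 𝒞 C → IsCoset (sumOf H) C × C ≢ sumOf H) →
  let open Construction H D 𝒞? in
  PairwiseDisjoint 𝒜
  × Bimodal 𝒜?
  × (∀ S → (𝒜 S × ∣ S ∣ < ∣ internalDifferenceGroup S ∣) ⇔ (∃ λ i → S ≡ A i))
  × (∀ i → internalDifferenceGroup (A i) ≡ H i)
  × (∀ i → H i ─ A i ≡ D × IsSubgroup (H i ─ A i))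
theorem3p11 G t 2≤t H D H≤G D≤G _ H∩H≡D 2<∣H∶D∣ 𝒞 𝒞? 𝒞-cosets =
  pairwiseDisjoint , bimodal , small-members , idg-A ,
  λ i → H─A≡D i , subst IsSubgroup (sym (H─A≡D i)) D≤G
  where
  open Subsets G using (IsSubgroup)
  open FiniteGroupSets G
  open Configuration 2≤t H≤G D≤G H∩H≡D 2<∣H∶D∣ 𝒞? 𝒞-cosets
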